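{- Let $T$ be a bounded saturation theory, let $G$ and $E$ be finite sets of predicates of $T$, and let $\tau_e := \mathit{SDP}_T(G,E)$. Then for every subset $G' \subseteq G$, $[\tau_e]_{G'} = {\tt true}$ if and only if $\mathit{DP}_T(G' \cup \widetilde{E})$ returns UNSATISFIABLE.
   Context: A predicate is an atomic formula or its negation; a finite set of predicates is identified with the conjunction of its elements. The theory $T$ comes with inference rules; a rule instance is written $g \mathrel{:- } g_1,\dots,g_k$, meaning that $g$ (a predicate, or the contradiction symbol $\bot$) can be derived in one step from predicates $g_1,\dots,g_k$. For a set $H$ of predicates, $\widetilde{H} := \{\neg h : h \in H\}$. Saturation procedure $\mathrm{Sat}_N(H)$ (for a finite set $H$ of predicates and integer $N\ge 0$): (1) $W := H$. (2) Repeat $N$ times: set $W' := W$; for every predicate $g \notin W'$ for which there is a rule instance $g \mathrel{:- } g_1,\dots,g_k$ with all $g_j \in W'$, add $g$ to $W$. (3) If there is a rule instance $\bot \mathrel{:- } g_1,\dots,g_k$ with all $g_j\in W$, return UNSATISFIABLE, otherwise SATISFIABLE. $T$ is a bounded saturation theory if there is a function $d_T$ assigning to each finite set $H$ of predicates a natural number $d_T(H)$ such that for every $N \ge d_T(H)$, $\mathrm{Sat}_N(H)$ returns UNSATISFIABLE iff $H$ is unsatisfiable in $T$. Write $\mathit{DP}_T(H) := \mathrm{Sat}_{d_T(H)}(H)$ and, for a finite set $S$, $D_T(S) := \max\{d_T(S') : S' \subseteq S\}$. Symbolic decision procedure $\mathit{SDP}_T(G,E)$: introduce a Boolean variable $b_g$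 for each $g\in G$ (the set $B_G$). Let $N := D_T(G\cup\widetilde{E})$. (1) $W := G \cup \widetilde{E}$; set $\tau_{(g,0)} := b_g$ for $g\in G$ and $\tau_{(\neg e_i,0)} := {\tt true}$ for $e_i\in E$. (2) For $i = 1,\dots,N$: $W' := W$; set $S(g) := \emptyset$ for every predicate $g$; for every $g\in W'$ add $\tau_{(g,i-1)}$ to $S(g)$; for every predicate $g$ and every rule instance $g \mathrel{:- } g_1,\dots,g_k$ with all $g_m \in W'$, add the conjunction $\bigwedge_{m=1}^k \tau_{(g_m,i-1)}$ to $S(g)$ and add $g$ to $W$; then for each $g \in W$ set $\tau_{(g,i)} := \bigvee_{d\in S(g)} d$ and $\tau_{(g,\top)} := \tau_{(g,i)}$. (3) Let $S(e)$ be the set of conjunctions $\bigwedge_{m=1}^k \tau_{(g_m,\top)}$ over all rule instances $\bot \mathrel{:- } g_1,\dots,g_k$ with $\{g_1,\dots,g_k\}\subseteq W$, and set $\tau_e := \bigvee_{d\in S(e)} d$ (empty disjunction is ${\tt false}$). (4) Return $\tau_e$, a negation-free Boolean expression (with shared subexpressions) whose leaves are in $B_G$ or are constants. For a Boolean expression $\tau$ with leaves in $B_G$ and $G'\subseteq G$, $[\tau]_{G'}$ is the truth value of $\tau$ obtained by replacing each leaf $b_g$ by ${\tt true}$ if $g\in G'$ and ${\tt false}$ otherwise, with $\wedge,\vee$ interpreted as usual. -}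

module Defs where

open import Level using (Level; _⊔_; suc)
open import Data.Bool.Base as Bool using (Bool; true; false)
open import Data.List.Base using (List; []; _∷_; _++_; map; mapMaybe; filter; foldr; null)
open import Data.List.Extrema.Nat using (max)
open import Data.List.Membership.Propositional using (_∈_)
import Data.List.Membership.DecPropositional as DecMembership
open import Data.List.Relation.Binary.BagAndSetEquality using (_∼[_]_; set)
open import Data.List.Relation.Unary.All using (All)
open import Data.Maybe.Base using (Maybe; just; nothing)
open import Data.Nat.Base as ℕ using (ℕ; _≤_)
open import Data.Product.Base using (Σ; ∃; _×_; _,_; proj₁; proj₂)
open import Function.Bundles using (_⇔_)
open import Relation.Binary.Definitions using (DecidableEquality)
open import Relation.Binary.PropositionalEquality.Core using (_≡_; refl; cong)
open import Relation.Nullary.Decidable.Core using (yes; no; does; map′)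
open import Relation.Nullary.Negation.Core using (¬_)

private
  variable
    a r m ℓ v : Level

-- Finite sets are represented by lists throughout, read up to having the
-- same members; union is _++_.

data Predicate (Atom : Set a) : Set a where
  pos : Atom → Predicate Atom
  neg : Atom → Predicate Atom

-- Double negations are cancelled, so that predicates are closed under negation.
negate : {Atom : Set a} → Predicate Atom → Predicate Atom
negate (pos p) = neg p
negate (neg p) = pos p

-- The set H̃.
negateAll : {Atom : Set a} → List (Predicate Atom) → List (Predicate Atom)
negateAll = map negate

data Conclusion (Atom : Set a) : Set a where
  derive        : Predicate Atom → Conclusion Atom
  contradictory : Conclusion Atom

module _ {Atom : Set a} (_≟_ : DecidableEquality Atom) where

  predicate-≟ : DecidableEquality (Predicate Atom)
  predicate-≟ (pos p) (pos q) = map′ (cong pos) (λ { refl → refl }) (p ≟ q)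
  predicate-≟ (neg p) (neg q) = map′ (cong neg) (λ { refl → refl }) (p ≟ q)
  predicate-≟ (pos _) (neg _) = no λ ()
  predicate-≟ (neg _) (pos _) = no λ ()

  conclusion-≟ : DecidableEquality (Conclusion Atom)
  conclusion-≟ (derive g)    (derive h)    = map′ (cong derive) (λ { refl → refl }) (predicate-≟ g h)
  conclusion-≟ contradictory contradictory = yes refl
  conclusion-≟ (derive _)    contradictory = no λ ()
  conclusion-≟ contradictory (derive _)    = no λ ()

-- An element of Model is a structure of the theory together with a valuation
-- of the free variables.
--
-- `instances W` enumerates the rule instances whose premises all lie in the
-- finite set W. That these are finitely many is what makes each iteration of
-- the saturation procedures terminate, and the disjunctions they build finite.
record Theory (a r m ℓ : Level) : Set (suc (a ⊔ r ⊔ m ⊔ ℓ)) where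
  infix 4 _:-_ _⊨ₐ_
  field
    Atom  : Set a
    _≟_   : DecidableEquality Atom

    Model : Set m
    _⊨ₐ_  : Model → Atom → Set ℓ

    _:-_      : Conclusion Atom → List (Predicate Atom) → Set r
    instances : List (Predicate Atom) → List (Conclusion Atom × List (Predicate Atom))
    instances-correct : ∀ W c gs → ((c , gs) ∈ instances W) ⇔ ((c :- gs) × All (_∈ W) gs)

  Pred : Set a
  Pred = Predicate Atom

  _⊨_ : Model → Pred → Set ℓ
  M ⊨ pos p = M ⊨ₐ p
  M ⊨ neg p = ¬ (M ⊨ₐ p)

  Satisfiable : List Pred → Set (a ⊔ m ⊔ ℓ)
  Satisfiable H = ∃ λ M → All (M ⊨_) H

  Unsatisfiable : List Pred → Set (a ⊔ m ⊔ ℓ)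
  Unsatisfiable H = ¬ Satisfiable H

  open DecMembership (predicate-≟ _≟_) public using (_∈?_; _∉?_)

  -- The premises of the rule instances with conclusion c applicable to W.
  premisesOf : Conclusion Atom → List Pred → List (List Pred)
  premisesOf c W = map proj₂ (filter (λ i → conclusion-≟ _≟_ (proj₁ i) c) (instances W))

  derivable : List Pred → List Pred
  derivable W = mapMaybe (λ i → derived (proj₁ i)) (instances W)
    where
    derived : Conclusion Atom → Maybe Pred
    derived (derive g)    = just g
    derived contradictory = nothing

data Result : Set where
  SATISFIABLE UNSATISFIABLE : Result

module _ (T : Theory a r m ℓ) where
  open Theory T

  saturate : ℕ → List Pred → List Pred
  saturate ℕ.zero    H = H
  saturate (ℕ.suc n) H = W′ ++ filter (_∉? W′) (derivable W′)
    where W′ = saturate n H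

  Sat : ℕ → List Pred → Result
  Sat N H = Bool.if null (premisesOf contradictory (saturate N H))
            then SATISFIABLE else UNSATISFIABLE

  -- d-cong makes d a function of the finite set, not of the list presenting it.
  record BoundedSaturation : Set (a ⊔ m ⊔ ℓ) where
    field
      d         : List Pred → ℕ
      d-cong    : ∀ {H K} → H ∼[ set ] K → d H ≡ d K
      d-correct : ∀ H N → d H ≤ N → (Sat N H ≡ UNSATISFIABLE) ⇔ Unsatisfiable H

subsets : {A : Set a} → List A → List (List A)
subsets []       = [] ∷ []
subsets (x ∷ xs) = subsets xs ++ map (x ∷_) (subsets xs)

data BoolExpr (V : Set v) : Set v where
  var   : V → BoolExpr V
  const : Bool → BoolExpr V
  _∧_   : BoolExpr V → BoolExpr V → BoolExpr V
  _∨_   : BoolExpr V → BoolExpr V → BoolExpr V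

⋀ ⋁ : {V : Set v} → List (BoolExpr V) → BoolExpr V
⋀ = foldr _∧_ (const true)
⋁ = foldr _∨_ (const false)

eval : {V : Set v} → (V → Bool) → BoolExpr V → Bool
eval ρ (var x)   = ρ x
eval ρ (const b) = b
eval ρ (s ∧ t)   = eval ρ s Bool.∧ eval ρ t
eval ρ (s ∨ t)   = eval ρ s Bool.∨ eval ρ t

module _ (T : Theory a r m ℓ) where
  open Theory T

  -- B_G: the variable b_g is the pair of g and its membership in G.
  BoolVar : List Pred → Set a
  BoolVar G = Σ Pred (_∈ G)

  -- [ τ ]_{G′}
  truthValue : {G : List Pred} → BoolExpr (BoolVar G) → List Pred → Bool
  truthValue τ G′ = eval (λ b → does (proj₁ b ∈? G′)) τ

  module _ (G E : List Pred) where

    -- The value after i iterations of the variable W of the symbolic procedure.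
    symW : ℕ → List Pred
    symW ℕ.zero    = G ++ negateAll E
    symW (ℕ.suc i) = symW i ++ derivable (symW i)

    -- τ g i is τ_(g,i), which is meaningful only for g ∈ symW i (elsewhere it
    -- is false). On G ∩ Ẽ the initial assignment of `true` overrides b_g.
    τ : Pred → ℕ → BoolExpr (BoolVar G)
    S : Pred → ℕ → List (BoolExpr (BoolVar G))

    τ g ℕ.zero with g ∈? negateAll E | g ∈? G
    ... | yes _ | _       = const true
    ... | no _  | yes g∈G = var (g , g∈G)
    ... | no _  | no _    = const false
    τ g (ℕ.suc i) = ⋁ (S g i)

    -- The set S(g) built in iteration i + 1.
    S g i = (Bool.if does (g ∈? symW i) then τ g i ∷ [] else [])
            ++ map (λ gs → ⋀ (map (λ h → τ h i) gs)) (premisesOf (derive g) (symW i))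

    -- τ_e after N iterations. Every member of W is reassigned in each
    -- iteration, so τ_(g,⊤) is τ_(g,N).
    symbolicSat : ℕ → BoolExpr (BoolVar G)
    symbolicSat N = ⋁ (map (λ gs → ⋀ (map (λ h → τ h N) gs)) (premisesOf contradictory (symW N)))

  module _ (B : BoundedSaturation T) where
    open BoundedSaturation B

    DP : List Pred → Result
    DP H = Sat T (d H) H

    D : List Pred → ℕ
    D H = max 0 (map d (subsets H))

    SDP : (G E : List Pred) → BoolExpr (BoolVar G)
    SDP G E = symbolicSat G E (D (G ++ negateAll E))

{-# OPTIONS --safe #-}
-- Under the valuation given by G′, τ_(g,i) is true exactly when g belongs to
-- the i-th stage of the saturation of G′ ∪ Ẽ, because one symbolic iteration
-- mirrors one saturation step.  Hence τ_e is true iff Sat_N (G′ ∪ Ẽ) returns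
-- UNSATISFIABLE, where N is the maximum of d over the subsets of G ∪ Ẽ.  Both N
-- and d (G′ ∪ Ẽ) are at least d (G′ ∪ Ẽ), so Sat with either number of
-- iterations decides unsatisfiability of G′ ∪ Ẽ.
module Submission where

open import Defs
open import Level using (Level)
open import Data.Bool.Base using (Bool; true; false; if_then_else_)
open import Data.List.Base using (List; []; _∷_; _++_; map; mapMaybe; filter)
open import Data.List.Extrema.Nat using (xs≤max)
open import Data.List.Membership.Propositional using (_∈_; find; lose)
open import Data.List.Membership.Propositional.Properties using (∈-++⁺ˡ; ∈-++⁺ʳ; ∈-++⁻; ∈-map⁺; ∈-map⁻; ∈-filter⁺; ∈-filter⁻)
open import Data.List.Relation.Binary.BagAndSetEquality using (_∼[_]_; set)
open import Data.List.Relation.Binary.Subset.Propositional using (_⊆_)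
open import Data.List.Relation.Binary.Subset.Propositional.Properties using (++⁺ˡ)
open import Data.List.Relation.Unary.All as All using (All; []; _∷_)
import Data.List.Relation.Unary.All.Properties as All
open import Data.List.Relation.Unary.Any as Any using (Any; here; there)
import Data.List.Relation.Unary.Any.Properties as Any
open import Data.Maybe.Base using (Maybe; just; nothing)
open import Data.Nat.Base using (zero; suc; _≤_)
open import Data.Nat.Properties using (≤-refl; ≤-trans; ≤-reflexive)
open import Data.Product.Base using (∃; _×_; _,_; proj₁; proj₂)
open import Data.Sum.Base using (_⊎_; inj₁; inj₂; [_,_]′)
open import Function.Base using (_∘_)
open import Function.Bundles using (_⇔_; mk⇔; Equivalence)
open import Relation.Binary.PropositionalEquality.Core using (_≡_; refl; subst)
open import Relation.Nullary.Decidable.Core using (yes; no; does)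
open import Relation.Nullary.Negation.Core using (contradiction)
open import Relation.Unary using (Decidable)

open Equivalence using (to; from)

private
  variable
    a b r m ℓ p v : Level
    A : Set a
    V : Set v

∈-mapMaybe⁺ : {B : Set b} (f : A → Maybe B) {x : A} {xs : List A} {y : B} →
              x ∈ xs → f x ≡ just y → y ∈ mapMaybe f xs
∈-mapMaybe⁺ f {x} (here refl) eq with f x | eq
... | just _ | refl = here refl
∈-mapMaybe⁺ f {xs = z ∷ _} (there x∈xs) eq with f z
... | just _  = there (∈-mapMaybe⁺ f x∈xs eq)
... | nothing = ∈-mapMaybe⁺ f x∈xs eq

∈-mapMaybe⁻ : {B : Set b} (f : A → Maybe B) (xs : List A) {y : B} →
              y ∈ mapMaybe f xs → ∃ λ x → x ∈ xs × f x ≡ just y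
∈-mapMaybe⁻ f (x ∷ xs) y∈ with f x in eq | y∈
... | just _  | here refl = x , here refl , eq
... | just _  | there y∈′ = let z , z∈xs , fz = ∈-mapMaybe⁻ f xs y∈′ in z , there z∈xs , fz
... | nothing | y∈′       = let z , z∈xs , fz = ∈-mapMaybe⁻ f xs y∈′ in z , there z∈xs , fz

filter∈subsets : {P : A → Set p} (P? : Decidable P) (xs : List A) → filter P? xs ∈ subsets xs
filter∈subsets P? []       = here refl
filter∈subsets P? (x ∷ xs) with does (P? x)
... | true  = ∈-++⁺ʳ (subsets xs) (∈-map⁺ (x ∷_) (filter∈subsets P? xs))
... | false = ∈-++⁺ˡ (filter∈subsets P? xs)

eval-⋁ : (ρ : V → Bool) (ts : List (BoolExpr V)) →
         (eval ρ (⋁ ts) ≡ true) ⇔ Any (λ t → eval ρ t ≡ true) ts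
eval-⋁ ρ []       = mk⇔ (λ ()) (λ ())
eval-⋁ ρ (t ∷ ts) with eval ρ t in eq
... | true  = mk⇔ (λ _ → here eq) (λ _ → refl)
... | false = mk⇔ (there ∘ to (eval-⋁ ρ ts)) λ where
  (here t≡true) → contradiction (subst (_≡ true) eq t≡true) λ ()
  (there ts∋)   → from (eval-⋁ ρ ts) ts∋

eval-⋀ : (ρ : V → Bool) (ts : List (BoolExpr V)) →
         (eval ρ (⋀ ts) ≡ true) ⇔ All (λ t → eval ρ t ≡ true) ts
eval-⋀ ρ []       = mk⇔ (λ _ → []) (λ _ → refl)
eval-⋀ ρ (t ∷ ts) with eval ρ t in eq
... | true  = mk⇔ (λ e → eq ∷ to (eval-⋀ ρ ts) e) (λ { (_ ∷ es) → from (eval-⋀ ρ ts) es })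
... | false = mk⇔ (λ ()) (λ { (e ∷ _) → contradiction (subst (_≡ true) eq e) λ () })

module _ (T : Theory a r m ℓ) where
  open Theory T

  Fires : Conclusion Atom → List Pred → Set _
  Fires c W = ∃ λ gs → (c :- gs) × All (_∈ W) gs

  ∈-premisesOf : ∀ c W gs → (gs ∈ premisesOf c W) ⇔ ((c :- gs) × All (_∈ W) gs)
  ∈-premisesOf c W gs = mk⇔ fwd bwd
    where
    concludes-c? : Decidable (λ i → proj₁ i ≡ c)
    concludes-c? i = conclusion-≟ _≟_ (proj₁ i) c
    fwd : gs ∈ premisesOf c W → (c :- gs) × All (_∈ W) gs
    fwd gs∈ with ∈-map⁻ proj₂ gs∈
    ... | _ , i∈ , refl with ∈-filter⁻ concludes-c? {xs = instances W} i∈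
    ...   | i∈W , refl = to (instances-correct W c gs) i∈W
    bwd : (c :- gs) × All (_∈ W) gs → gs ∈ premisesOf c W
    bwd fires = ∈-map⁺ proj₂ (∈-filter⁺ concludes-c? (from (instances-correct W c gs) fires) refl)

  ∈-derivable : ∀ g W → (g ∈ derivable W) ⇔ Fires (derive g) W
  ∈-derivable g W = mk⇔ fwd bwd
    where
    fwd : g ∈ derivable W → Fires (derive g) W
    fwd g∈ with ∈-mapMaybe⁻ _ (instances W) g∈
    -- The case of a contradictory conclusion is absent: `mapMaybe` sends it to `nothing`, which is
    -- never `just g`.
    ... | (derive _ , gs) , i∈ , refl = gs , to (instances-correct W _ gs) i∈
    bwd : Fires (derive g) W → g ∈ derivable W
    bwd (gs , fires) = ∈-mapMaybe⁺ _ (from (instances-correct W _ gs) fires) refl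

  Sat-UNSATISFIABLE : ∀ N H → (Sat T N H ≡ UNSATISFIABLE) ⇔ Fires contradictory (saturate T N H)
  -- Abstracting `∈-premisesOf` together with the list makes its type follow the split on emptiness.
  Sat-UNSATISFIABLE N H with premisesOf contradictory (saturate T N H)
                           | ∈-premisesOf contradictory (saturate T N H)
  ... | []     | ∈-prem = mk⇔ (λ ()) (λ { (gs , fires) → contradiction (from (∈-prem gs) fires) λ () })
  ... | gs ∷ _ | ∈-prem = mk⇔ (λ _ → gs , to (∈-prem gs) (here refl)) (λ _ → refl)

  -- The filter drops only predicates that the left half of the append already contains, so as a set
  -- the stage grows by exactly the fired conclusions.
  saturate-suc : ∀ n H {g} → (g ∈ saturate T (suc n) H) ⇔
                 (g ∈ saturate T n H ⊎ Fires (derive g) (saturate T n H))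
  saturate-suc n H {g} = mk⇔ fwd bwd
    where
    W′ = saturate T n H
    fwd : g ∈ saturate T (suc n) H → g ∈ W′ ⊎ Fires (derive g) W′
    fwd g∈ with ∈-++⁻ W′ g∈
    ... | inj₁ g∈W′ = inj₁ g∈W′
    ... | inj₂ g∈f  = inj₂ (to (∈-derivable g W′) (proj₁ (∈-filter⁻ (_∉? W′) g∈f)))
    bwd : g ∈ W′ ⊎ Fires (derive g) W′ → g ∈ saturate T (suc n) H
    bwd (inj₁ g∈W′) = ∈-++⁺ˡ g∈W′
    bwd (inj₂ fires) with g ∈? W′
    ... | yes g∈W′ = ∈-++⁺ˡ g∈W′
    ... | no  g∉W′ = ∈-++⁺ʳ W′ (∈-filter⁺ (_∉? W′) (from (∈-derivable g W′) fires) g∉W′)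

  -- A conjunction built from premises in the larger set `W` is true only if all of them lie in `X`;
  -- conversely, `X ⊆ W` ensures that every instance applicable to `X` is enumerated. Leaving `c`
  -- general serves both an iteration step and the final contradiction test.
  Any-premises⇔Fires : (ρ : V → Bool) (σ : Pred → BoolExpr V) (X W : List Pred) →
    (∀ h → (eval ρ (σ h) ≡ true) ⇔ (h ∈ X)) → X ⊆ W → ∀ c →
    Any (λ t → eval ρ t ≡ true) (map (λ gs → ⋀ (map σ gs)) (premisesOf c W)) ⇔ Fires c X
  Any-premises⇔Fires ρ σ X W σ⇔X X⊆W c = mk⇔ fwd bwd
    where
    fwd : Any (λ t → eval ρ t ≡ true) (map (λ gs → ⋀ (map σ gs)) (premisesOf c W)) → Fires c X
    fwd any with find (Any.map⁻ any)
    ... | gs , gs∈ , e =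
      gs , proj₁ (to (∈-premisesOf c W gs) gs∈)
         , All.map (λ {h} → to (σ⇔X h)) (All.map⁻ (to (eval-⋀ ρ (map σ gs)) e))
    bwd : Fires c X → Any (λ t → eval ρ t ≡ true) (map (λ gs → ⋀ (map σ gs)) (premisesOf c W))
    bwd (gs , rule , gs⊆X) = Any.map⁺ (lose
      (from (∈-premisesOf c W gs) (rule , All.map X⊆W gs⊆X))
      (from (eval-⋀ ρ (map σ gs)) (All.map⁺ (All.map (λ {h} → from (σ⇔X h)) gs⊆X))))

  module _ (G E G′ : List Pred) (G′⊆G : G′ ⊆ G) where

    private
      H : List Pred
      H = G′ ++ negateAll E

      ρ : BoolVar T G → Bool
      ρ (g , _) = does (g ∈? G′)

    -- Derivation is monotone, and the symbolic run starts from a larger set.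
    saturate⊆symW : ∀ i → saturate T i H ⊆ symW T G E i
    saturate⊆symW zero    = ++⁺ˡ (negateAll E) G′⊆G
    saturate⊆symW (suc i) g∈ with to (saturate-suc i H) g∈
    ... | inj₁ g∈i = ∈-++⁺ˡ (saturate⊆symW i g∈i)
    ... | inj₂ (gs , rule , gs⊆) = ∈-++⁺ʳ (symW T G E i)
      (from (∈-derivable _ _) (gs , rule , All.map (saturate⊆symW i) gs⊆))

    -- Ranging over all `g`, also those outside `symW T G E i`, lets the induction hypothesis be
    -- passed directly to `Any-premises⇔Fires`.
    eval-τ⇔∈saturate : ∀ i g → (eval ρ (τ T G E g i) ≡ true) ⇔ (g ∈ saturate T i H)
    eval-τ⇔∈saturate zero g with g ∈? negateAll E | g ∈? G
    -- On the overlap with `G` the constant `true` is the right value, since such a predicate lies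
    -- in `H` for every `G′`.
    ... | yes g∈Ẽ | _       = mk⇔ (λ _ → ∈-++⁺ʳ G′ g∈Ẽ) (λ _ → refl)
    ... | no g∉Ẽ  | no g∉G  = mk⇔ (λ ()) λ g∈H →
      contradiction (∈-++⁻ G′ g∈H) [ g∉G ∘ G′⊆G , g∉Ẽ ]′
    ... | no g∉Ẽ  | yes g∈G with g ∈? G′
    ...   | yes g∈G′ = mk⇔ (λ _ → ∈-++⁺ˡ g∈G′) (λ _ → refl)
    ...   | no g∉G′  = mk⇔ (λ ()) λ g∈H → contradiction (∈-++⁻ G′ g∈H) [ g∉G′ , g∉Ẽ ]′
    eval-τ⇔∈saturate (suc i) g = mk⇔
      (from (saturate-suc i H) ∘ fwd ∘ to (eval-⋁ ρ (S T G E g i)))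
      (from (eval-⋁ ρ (S T G E g i)) ∘ bwd ∘ to (saturate-suc i H))
      where
      W = symW T G E i
      carried = if does (g ∈? W) then τ T G E g i ∷ [] else []

      fires⇔ = Any-premises⇔Fires ρ (λ h → τ T G E h i) (saturate T i H) W
                 (eval-τ⇔∈saturate i) (saturate⊆symW i) (derive g)

      carried⁻ : Any (λ t → eval ρ t ≡ true) carried → eval ρ (τ T G E g i) ≡ true
      carried⁻ any with does (g ∈? W) | any
      ... | true | here e = e

      carried⁺ : g ∈ W → eval ρ (τ T G E g i) ≡ true → Any (λ t → eval ρ t ≡ true) carried
      carried⁺ g∈W e with g ∈? W
      ... | yes _  = here e
      ... | no g∉W = contradiction g∈W g∉W

      fwd : Any (λ t → eval ρ t ≡ true) (S T G E g i) →
            g ∈ saturate T i H ⊎ Fires (derive g) (saturate T i H)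
      fwd any with Any.++⁻ carried any
      ... | inj₁ any₁ = inj₁ (to (eval-τ⇔∈saturate i g) (carried⁻ any₁))
      ... | inj₂ any₂ = inj₂ (to fires⇔ any₂)

      bwd : g ∈ saturate T i H ⊎ Fires (derive g) (saturate T i H) →
            Any (λ t → eval ρ t ≡ true) (S T G E g i)
      -- The old value enters `S` only for members of `W`, so membership in the concrete stage is
      -- first transferred to the symbolic one.
      bwd (inj₁ g∈)    = Any.++⁺ˡ (carried⁺ (saturate⊆symW i g∈) (from (eval-τ⇔∈saturate i g) g∈))
      bwd (inj₂ fires) = Any.++⁺ʳ carried (from fires⇔ fires)

    -- The invariant at stage `N` identifies the final disjunction with the contradiction test of
    -- `Sat`; how large `N` is matters only when the result is compared with `DP`.
    symbolicSat-correct : ∀ N →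
      (truthValue T (symbolicSat T G E N) G′ ≡ true) ⇔ (Sat T N H ≡ UNSATISFIABLE)
    symbolicSat-correct N = mk⇔
      (from (Sat-UNSATISFIABLE N H) ∘ to fires⇔ ∘ to (eval-⋁ ρ _))
      (from (eval-⋁ ρ _) ∘ from fires⇔ ∘ to (Sat-UNSATISFIABLE N H))
      where
      fires⇔ = Any-premises⇔Fires ρ (λ h → τ T G E h N) (saturate T N H) (symW T G E N)
                 (eval-τ⇔∈saturate N) (saturate⊆symW N) contradictory

  module _ (B : BoundedSaturation T) where
    open BoundedSaturation B

    -- `subsets K` need not contain the list H itself, only one with the same
    -- members; hence the appeal to d-cong.
    d≤D : ∀ {H K} → H ⊆ K → d H ≤ D T B K
    d≤D {H} {K} H⊆K = ≤-trans (≤-reflexive (d-cong H∼K∩H))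
      (All.lookup (xs≤max 0 (map d (subsets K))) (∈-map⁺ d (filter∈subsets (_∈? H) K)))
      where
      H∼K∩H : H ∼[ set ] filter (_∈? H) K
      H∼K∩H = mk⇔ (λ x∈H → ∈-filter⁺ (_∈? H) (H⊆K x∈H) x∈H)
                  (proj₂ ∘ ∈-filter⁻ (_∈? H) {xs = K})

theorem3p3 : ∀ {a r m ℓ : Level} (T : Theory a r m ℓ) (B : BoundedSaturation T) (G E : List (Theory.Pred T)) →
    let τₑ = SDP T B G E in
    ∀ (G′ : List (Theory.Pred T)) → G′ ⊆ G →
    (truthValue T τₑ G′ ≡ true) ⇔ (DP T B (G′ ++ negateAll E) ≡ UNSATISFIABLE)
theorem3p3 T B G E G′ G′⊆G = mk⇔
  (from dec ∘ to decN ∘ to symb)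
  (from symb ∘ from decN ∘ to dec)
  where
  open BoundedSaturation B
  H = G′ ++ negateAll E
  N = D T B (G ++ negateAll E)
  symb = symbolicSat-correct T G E G′ G′⊆G N
  -- Unsatisfiability of `H` links the two iteration counts, so the stages after `d H` and after `N`
  -- steps are never compared directly.
  decN = d-correct H N (d≤D T B (++⁺ˡ (negateAll E) G′⊆G))
  dec  = d-correct H (d H) ≤-refl
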